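{- Given a reduced tree automaton $\mathcal{A}$ over $\Sigma$, it is decidable whether the tree language $L$ recognised by $\mathcal{A}$ is slim or fat. Moreover, if $L$ is slim, then $L\subseteq T^{2^{n-1}}_\Sigma$, where $n$ is the number of states of $\mathcal{A}$.
   Context: A tree domain is a non-empty finite prefix-closed set $D\subseteq\{0,1\}^\star$ such that for every $u\in D$: $u0\in D$ iff $u1\in D$. A tree over a finite alphabet $\Sigma$ is a map $t\colon D\to\Sigma$ with $\operatorname{dom}(t)=D$ a tree domain; $T_\Sigma$ is the set of all trees. The thickness of $t$ is $\max_{\ell\ge 0}|\operatorname{dom}(t)\cap\{0,1\}^\ell|$; $T^K_\Sigma$ is the set of trees of thickness at most $K$. A language $L\subseteq T_\Sigma$ is slim if $L\subseteq T^K_\Sigma$ for some $K\ge1$, and fat otherwise. A (deterministic bottom-up) tree automaton is $\mathcal{A}=(Q,\iota,\delta,F)$ with finite $Q$, $\iota\colon\Sigma\to Q$, $\delta\colon\Sigma\times Q\times Q\to Q$, $F\subseteq Q$; $\mathcal{A}(t)=\iota(t(\epsilon))$ if $\operatorname{dom}(t)=\{\epsilon\}$ and $\mathcal{A}(t)=\delta(t(\epsilon),\mathcal{A}(t\restriction0),\mathcal{A}(t\restriction1))$ otherwise, where $t\restriction u$ is the subtree $v\mapsto t(uv)$; it recognises $\{t:\mathcal{A}(t)\in F\}$. $\mathcal{A}$ is reduced if for every $q\in Q$ there is a tree $t$ with $\mathcal{A}(t)=q$. -}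

module Defs where

open import Data.Nat using (ℕ; zero; suc; _+_; _⊔_; _≤_)
open import Data.Fin using (Fin)
open import Data.Bool using (Bool; true)
open import Data.Product using (Σ; ∃; _×_)
open import Relation.Binary.PropositionalEquality using (_≡_)

-- A tree domain (prefix-closed,
-- every node has 0 or 2 children) labelled by letters is exactly a full
-- binary tree: leaf a has domain {ε}; node a l r has children 0 ↦ l, 1 ↦ r.
data Tree (m : ℕ) : Set where
  leaf : Fin m → Tree m
  node : Fin m → Tree m → Tree m → Tree m

width : ∀ {m} → Tree m → ℕ → ℕ
width (leaf a)     zero    = 1
width (leaf a)     (suc ℓ) = 0
width (node a l r) zero    = 1
width (node a l r) (suc ℓ) = width l ℓ + width r ℓ

height : ∀ {m} → Tree m → ℕ
height (leaf a)     = 0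
height (node a l r) = suc (height l ⊔ height r)

maxUpTo : (ℕ → ℕ) → ℕ → ℕ
maxUpTo f zero    = f zero
maxUpTo f (suc k) = f (suc k) ⊔ maxUpTo f k

-- thickness t = max_{ℓ ≥ 0} width t ℓ  (widths above the height are 0)
thickness : ∀ {m} → Tree m → ℕ
thickness t = maxUpTo (width t) (height t)

record Automaton (m n : ℕ) : Set where
  field
    ι : Fin m → Fin n
    δ : Fin m → Fin n → Fin n → Fin n
    F : Fin n → Bool

module _ {m n : ℕ} (A : Automaton m n) where
  open Automaton A

  run : Tree m → Fin n
  run (leaf a)     = ι a
  run (node a l r) = δ a (run l) (run r)

  Accepts : Tree m → Set
  Accepts t = F (run t) ≡ true

  Reduced : Set
  Reduced = (q : Fin n) → ∃ λ (t : Tree m) → run t ≡ q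

  LangThickness≤ : ℕ → Set
  LangThickness≤ K = (t : Tree m) → Accepts t → thickness t ≤ K

  -- L(A) is slim (fat = ¬ Slim)
  Slim : Set
  Slim = Σ ℕ λ K → (1 ≤ K) × LangThickness≤ K

module Submission where

-- Call a state tall if the trees reaching it have nodes at every depth, and fat if their
-- widths are unbounded.  Unless the state of t is fat, every level of t has at most 2^(k-1)
-- nodes, k the number of states in the run on t.  By induction on t: if the root state does
-- not recur below the root, both children use fewer states than t.  If it recurs in a child,
-- the root state is tall, and pumping that loop beside a tall sibling would make it fat; so
-- the sibling's nonempty levels number fewer than its states, whence y + 2 ≤ k for a nonempty
-- level y of the sibling, and level y + 1 of t has at most 2^(y+1) ≤ 2^(k-1) nodes.  Hence L
-- is fat iff some tree reaching an accepting state has a level wider than 2^(n-1).  The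
-- per-state maximal widths, capped just above 2^(n-1), evolve level by level as bounded
-- vectors each determining the next, so only finitely many levels need to be inspected.

open import Defs
open import Data.Nat using (ℕ; _^_; _∸_)
open import Data.Product using (_×_)
open import Relation.Nullary using (Dec)

open import Data.Bool using (true)
open import Data.Bool.Properties using () renaming (_≟_ to _≟ᵇ_)
open import Data.Empty using (⊥-elim)
open import Data.Fin as Fin using (Fin; toℕ; fromℕ<; funToFin; finToFun)
open import Data.Fin.Properties using (pigeonhole; toℕ<n; toℕ-fromℕ<; finToFun-funToFin; any?; all?)
  renaming (_≟_ to _≟ᶠ_)
open import Data.Fin.Subset using (Subset; ⁅_⁆; _∪_; _∈_; _∉_; _⊆_; ∣_∣)
open import Data.Fin.Subset.Properties
  using (x∈⁅x⁆; x∈⁅y⁆⇒x≡y; x∈p∪q⁻; x∈p∪q⁺; ∣⁅x⁆∣≡1; p⊆q⇒∣p∣≤∣q∣; p⊂q⇒∣p∣<∣q∣; ∣p∣≤n; _∈?_)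
open import Data.Nat using (zero; suc; _+_; _≤_; _<_; _>_; _⊔_; _⊓_; z≤n; s≤s; s≤s⁻¹; _≤?_; _≟_)
open import Data.Nat.Induction using (<-rec)
open import Data.Nat.Properties
open import Data.Product using (∃-syntax; _,_)
open import Data.Sum using (_⊎_; inj₁; inj₂)
open import Function using (_∘_)
open import Relation.Binary.PropositionalEquality
open import Relation.Nullary using (yes; no; ¬_)
open import Relation.Nullary.Decidable using (map′; ¬?; _→-dec_)

m+n>0⇒m>0⊎n>0 : ∀ m {n} → m + n > 0 → m > 0 ⊎ n > 0
m+n>0⇒m>0⊎n>0 zero    n>0 = inj₂ n>0
m+n>0⇒m>0⊎n>0 (suc m) _   = inj₁ (s≤s z≤n)

2^m+2^n≤2^o : ∀ {m n o} → m < o → n < o → 2 ^ m + 2 ^ n ≤ 2 ^ o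
2^m+2^n≤2^o {m} {n} {suc o} (s≤s m≤o) (s≤s n≤o) = begin
  2 ^ m + 2 ^ n  ≤⟨ +-mono-≤ (^-monoʳ-≤ 2 m≤o) (^-monoʳ-≤ 2 n≤o) ⟩
  2 ^ o + 2 ^ o  ≡⟨ cong (2 ^ o +_) (+-identityʳ (2 ^ o)) ⟨
  2 ^ suc o      ∎
  where open ≤-Reasoning

m⊓[n+o]≤m⊓n+m⊓o : ∀ m n o → m ⊓ (n + o) ≤ m ⊓ n + m ⊓ o
m⊓[n+o]≤m⊓n+m⊓o m n o with ≤-total m n
... | inj₁ m≤n = begin
  m ⊓ (n + o)        ≤⟨ m⊓n≤m m (n + o) ⟩
  m                  ≡⟨ m≤n⇒m⊓n≡m m≤n ⟨
  m ⊓ n              ≤⟨ m≤m+n (m ⊓ n) (m ⊓ o) ⟩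
  m ⊓ n + m ⊓ o      ∎
  where open ≤-Reasoning
... | inj₂ n≤m = begin
  m ⊓ (n + o)        ≤⟨ ⊓-monoˡ-≤ (n + o) (m≤n+m m n) ⟩
  (n + m) ⊓ (n + o)  ≡⟨ +-distribˡ-⊓ n m o ⟨
  n + m ⊓ o          ≡⟨ cong (_+ m ⊓ o) (m≥n⇒m⊓n≡n n≤m) ⟨
  m ⊓ n + m ⊓ o      ∎
  where open ≤-Reasoning

x∈p⇒∣p∣>0 : ∀ {n} {x : Fin n} {p : Subset n} → x ∈ p → ∣ p ∣ > 0
x∈p⇒∣p∣>0 {x = x} x∈p = subst (_≤ _) (∣⁅x⁆∣≡1 x)
  (p⊆q⇒∣p∣≤∣q∣ (λ y∈⁅x⁆ → subst (_∈ _) (sym (x∈⁅y⁆⇒x≡y x y∈⁅x⁆)) x∈p))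

⨆ : ∀ k → (Fin k → ℕ) → ℕ
⨆ zero    f = 0
⨆ (suc k) f = f Fin.zero ⊔ ⨆ k (f ∘ Fin.suc)

≤-⨆ : ∀ {k} (f : Fin k → ℕ) i → f i ≤ ⨆ k f
≤-⨆ f Fin.zero    = m≤m⊔n _ _
≤-⨆ f (Fin.suc i) = ≤-trans (≤-⨆ (f ∘ Fin.suc) i) (m≤n⊔m _ _)

⨆-preserves : ∀ (P : ℕ → Set) {k} {f : Fin k → ℕ} → P 0 → (∀ i → P (f i)) → P (⨆ k f)
⨆-preserves P {zero}      P0 _  = P0
⨆-preserves P {suc k} {f} P0 Pf with ⊔-sel (f Fin.zero) (⨆ k (f ∘ Fin.suc))
... | inj₁ eq = subst P (sym eq) (Pf Fin.zero)
... | inj₂ eq = subst P (sym eq) (⨆-preserves P P0 (Pf ∘ Fin.suc))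

⨆-cong : ∀ {k} {f g : Fin k → ℕ} → f ≗ g → ⨆ k f ≡ ⨆ k g
⨆-cong {zero}  f≗g = refl
⨆-cong {suc k} f≗g = cong₂ _⊔_ (f≗g Fin.zero) (⨆-cong (f≗g ∘ Fin.suc))

-- Pigeonhole on the (c+1)ⁿ possible terms, then shift the repetition forward.
early-occurrence : ∀ {n c} (s : ℕ → Fin n → ℕ) → (∀ y p → s y p ≤ c) →
                   (∀ {i j} → s i ≗ s j → s (suc i) ≗ s (suc j)) →
                   ∀ y → ∃[ i ] i ≤ suc c ^ n × s i ≗ s y
early-occurrence {n} {c} s s≤c next = <-rec _ occurrence
  where
  N = suc c ^ n

  code : ℕ → Fin N
  code y = funToFin (λ p → fromℕ< (s≤s (s≤c y p)))

  code-injective : ∀ {i j} → code i ≡ code j → s i ≗ s j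
  code-injective {i} {j} eq p = begin
    s i p                     ≡⟨ toℕ-fromℕ< _ ⟨
    toℕ (fromℕ< _)            ≡⟨ cong toℕ (finToFun-funToFin _ p) ⟨
    toℕ (finToFun (code i) p) ≡⟨ cong (λ x → toℕ (finToFun x p)) eq ⟩
    toℕ (finToFun (code j) p) ≡⟨ cong toℕ (finToFun-funToFin _ p) ⟩
    toℕ (fromℕ< _)            ≡⟨ toℕ-fromℕ< _ ⟩
    s j p                     ∎
    where open ≡-Reasoning

  shift : ∀ {i j} → s i ≗ s j → ∀ k → s (k + i) ≗ s (k + j)
  shift eq zero    = eq
  shift eq (suc k) = next (shift eq k)

  occurrence : ∀ y → (∀ {y′} → y′ < y → ∃[ i ] i ≤ N × s i ≗ s y′) → ∃[ i ] i ≤ N × s i ≗ s y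
  occurrence y earlier with y ≤? N
  ... | yes y≤N = y , y≤N , λ _ → refl
  ... | no  y≰N =
    let i , j , i<j , same-code = pigeonhole (n<1+n N) (code ∘ toℕ)
        k = y ∸ toℕ j
        k+j≡y = m∸n+n≡m (≤-trans (s≤s⁻¹ (toℕ<n j)) (<⇒≤ (≰⇒> y≰N)))
        i′ , i′≤N , i′≗ = earlier (subst (k + toℕ i <_) k+j≡y (+-monoʳ-< k i<j))
    in i′ , i′≤N , λ p → begin
      s i′ p          ≡⟨ i′≗ p ⟩
      s (k + toℕ i) p ≡⟨ shift (code-injective same-code) k p ⟩
      s (k + toℕ j) p ≡⟨ cong (λ z → s z p) k+j≡y ⟩
      s y p           ∎
    where open ≡-Reasoning

module _ {m : ℕ} where

  width-zero : (t : Tree m) → width t 0 ≡ 1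
  width-zero (leaf a)     = refl
  width-zero (node a l r) = refl

  width≤2^ : (t : Tree m) → ∀ y → width t y ≤ 2 ^ y
  width≤2^ (leaf a)     zero    = ≤-refl
  width≤2^ (leaf a)     (suc y) = z≤n
  width≤2^ (node a l r) zero    = ≤-refl
  width≤2^ (node a l r) (suc y) = begin
    width l y + width r y  ≤⟨ +-mono-≤ (width≤2^ l y) (width≤2^ r y) ⟩
    2 ^ y + 2 ^ y          ≡⟨ cong (2 ^ y +_) (+-identityʳ (2 ^ y)) ⟨
    2 ^ suc y              ∎
    where open ≤-Reasoning

  width-pos-antitone : (t : Tree m) → ∀ {y y′} → y ≤ y′ → width t y′ > 0 → width t y > 0
  width-pos-antitone t            {zero}  _          _   = ≤-reflexive (sym (width-zero t))
  width-pos-antitone (leaf a)     {suc y} (s≤s _)    ()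
  width-pos-antitone (node a l r) {suc y} (s≤s y≤y′) w>0 with m+n>0⇒m>0⊎n>0 (width l _) w>0
  ... | inj₁ wl>0 = ≤-trans (width-pos-antitone l y≤y′ wl>0) (m≤m+n _ _)
  ... | inj₂ wr>0 = ≤-trans (width-pos-antitone r y≤y′ wr>0) (m≤n+m _ _)

  width-above-height : (t : Tree m) → ∀ {y} → height t < y → width t y ≡ 0
  width-above-height (leaf a)     {suc y} _       = refl
  width-above-height (node a l r) {suc y} (s≤s h) =
    cong₂ _+_ (width-above-height l (<-≤-trans (s≤s (m≤m⊔n _ _)) h))
              (width-above-height r (<-≤-trans (s≤s (m≤n⊔m _ _)) h))

  ≤-maxUpTo : ∀ f {k y} → y ≤ k → f y ≤ maxUpTo f k
  ≤-maxUpTo f {zero}  y≤0 rewrite n≤0⇒n≡0 y≤0 = ≤-refl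
  ≤-maxUpTo f {suc k} {y} y≤1+k with y ≤? k
  ... | yes y≤k = ≤-trans (≤-maxUpTo f y≤k) (m≤n⊔m _ _)
  ... | no  y≰k rewrite ≤-antisym y≤1+k (≰⇒> y≰k) = m≤m⊔n _ _

  maxUpTo-lub : ∀ f k {b} → (∀ y → f y ≤ b) → maxUpTo f k ≤ b
  maxUpTo-lub f zero    f≤b = f≤b 0
  maxUpTo-lub f (suc k) f≤b = ⊔-lub (f≤b (suc k)) (maxUpTo-lub f k f≤b)

  width≤thickness : (t : Tree m) → ∀ y → width t y ≤ thickness t
  width≤thickness t y with y ≤? height t
  ... | yes y≤h = ≤-maxUpTo (width t) y≤h
  ... | no  y≰h rewrite width-above-height t (≰⇒> y≰h) = z≤n

  thickness-lub : (t : Tree m) → ∀ {b} → (∀ y → width t y ≤ b) → thickness t ≤ b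
  thickness-lub t = maxUpTo-lub (width t) (height t)

  -- Naming a child by its direction lets every argument about "a child and its sibling" be made once.
  data Dir : Set where
    ↙ ↘ : Dir

  attach : Dir → Fin m → Tree m → Tree m → Tree m
  attach ↙ a c o = node a c o
  attach ↘ a c o = node a o c

  width-attach : ∀ d a c o y → width (attach d a c o) (suc y) ≡ width c y + width o y
  width-attach ↙ a c o y = refl
  width-attach ↘ a c o y = +-comm (width o y) (width c y)

  data Subtree : Tree m → Tree m → ℕ → Set where
    here : ∀ {t} → Subtree t t 0
    down : ∀ {a c o s D} d → Subtree c s D → Subtree (attach d a c o) s (suc D)

  graft : ∀ {t s D} → Subtree t s D → Tree m → Tree m
  graft here                 u = u
  graft (down {a} {o = o} d P) u = attach d a (graft P u) o

  width-graft : ∀ {t s D} (P : Subtree t s D) u y → width u y ≤ width (graft P u) (D + y)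
  width-graft here u y = ≤-refl
  width-graft (down {a} {o = o} {D = D} d P) u y = begin
    width u y                                      ≤⟨ width-graft P u y ⟩
    width (graft P u) (D + y)                      ≤⟨ m≤m+n _ _ ⟩
    width (graft P u) (D + y) + width o (D + y)    ≡⟨ width-attach d a (graft P u) o (D + y) ⟨
    width (attach d a (graft P u) o) (suc D + y)   ∎
    where open ≤-Reasoning

module _ {m n : ℕ} (A : Automaton m n) where
  open Automaton A

  state : Tree m → Fin n
  state = run A

  state-attach : ∀ d a {c c′ o o′} → state c ≡ state c′ → state o ≡ state o′ →
                 state (attach d a c o) ≡ state (attach d a c′ o′)
  state-attach ↙ a c≡c′ o≡o′ = cong₂ (δ a) c≡c′ o≡o′
  state-attach ↘ a c≡c′ o≡o′ = cong₂ (δ a) o≡o′ c≡c′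

  state-graft : ∀ {t s D} (P : Subtree t s D) {u} → state u ≡ state s → state (graft P u) ≡ state t
  state-graft here       u≡s = u≡s
  state-graft (down d P) u≡s = state-attach d _ (state-graft P u≡s) refl

  states : Tree m → Subset n
  states (leaf a)         = ⁅ ι a ⁆
  states t@(node a l r)   = ⁅ state t ⁆ ∪ (states l ∪ states r)

  state∈states : ∀ t → state t ∈ states t
  state∈states (leaf a)     = x∈⁅x⁆ _
  state∈states (node a l r) = x∈p∪q⁺ (inj₁ (x∈⁅x⁆ _))

  states-attach-child : ∀ d a c o → states c ⊆ states (attach d a c o)
  states-attach-child ↙ a c o p∈ = x∈p∪q⁺ (inj₂ (x∈p∪q⁺ (inj₁ p∈)))
  states-attach-child ↘ a c o p∈ = x∈p∪q⁺ (inj₂ (x∈p∪q⁺ (inj₂ p∈)))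

  states-attach-sibling : ∀ d a c o → states o ⊆ states (attach d a c o)
  states-attach-sibling ↙ a c o = states-attach-child ↘ a o c
  states-attach-sibling ↘ a c o = states-attach-child ↙ a o c

  ∣states∣-< : ∀ t c → states c ⊆ states t → state t ∉ states c → ∣ states c ∣ < ∣ states t ∣
  ∣states∣-< t c c⊆t t∉c = p⊂q⇒∣p∣<∣q∣ (c⊆t , _ , state∈states t , t∉c)

  ∈states⇒subtree : ∀ t {p} → p ∈ states t → ∃[ s ] ∃[ D ] Subtree t s D × state s ≡ p
  ∈states⇒subtree (leaf a) p∈ = leaf a , 0 , here , sym (x∈⁅y⁆⇒x≡y _ p∈)
  ∈states⇒subtree t@(node a l r) p∈ with x∈p∪q⁻ ⁅ state t ⁆ _ p∈
  ... | inj₁ p∈root = t , 0 , here , sym (x∈⁅y⁆⇒x≡y _ p∈root)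
  ... | inj₂ p∈l∪r with x∈p∪q⁻ (states l) (states r) p∈l∪r
  ...   | inj₁ p∈l = let s , D , P , s≡p = ∈states⇒subtree l p∈l in s , suc D , down ↙ P , s≡p
  ...   | inj₂ p∈r = let s , D , P , s≡p = ∈states⇒subtree r p∈r in s , suc D , down ↘ P , s≡p

  HasWidth : Fin n → ℕ → ℕ → Set
  HasWidth p y k = ∃[ u ] state u ≡ p × k ≤ width u y

  Tall : Fin n → Set
  Tall p = ∀ y → HasWidth p y 1

  Fat : Fin n → Set
  Fat p = ∀ k → ∃[ y ] HasWidth p y k

  HasWidth-≤ : ∀ {p y k k′} → k ≤ k′ → HasWidth p y k′ → HasWidth p y k
  HasWidth-≤ k≤k′ (u , u≡p , k′≤w) = u , u≡p , ≤-trans k≤k′ k′≤w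

  graft-HasWidth : ∀ {t s D y k} → Subtree t s D → HasWidth (state s) y k → HasWidth (state t) (D + y) k
  graft-HasWidth P (u , u≡s , k≤w) = graft P u , state-graft P u≡s , ≤-trans k≤w (width-graft P u _)

  tall-up : ∀ {t s D} → Subtree t s D → Tall (state s) → Tall (state t)
  tall-up {D = D} P tall y =
    let u , u≡t , w>0 = graft-HasWidth P (tall y) in u , u≡t , width-pos-antitone u (m≤n+m y D) w>0

  fat-up : ∀ {t s D} → Subtree t s D → Fat (state s) → Fat (state t)
  fat-up {D = D} P fat k = let y , wide = fat k in D + y , graft-HasWidth P wide

  tall-loop : ∀ {t s D} → Subtree t s (suc D) → state s ≡ state t → Tall (state t)
  tall-loop {t}         P s≡t zero    = t , refl , ≤-reflexive (sym (width-zero t))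
  tall-loop {D = D} P s≡t (suc y) =
    let u , u≡t , w>0 = graft-HasWidth P (subst (λ p → HasWidth p y 1) (sym s≡t) (tall-loop P s≡t y))
    in u , u≡t , width-pos-antitone u (s≤s (m≤n+m y D)) w>0

  tall-in-states : ∀ {p} t → Tall p → p ∈ states t → Tall (state t)
  tall-in-states t tall p∈ =
    let s , D , P , s≡p = ∈states⇒subtree t p∈ in tall-up P (subst Tall (sym s≡p) tall)

  -- Pumping: graft a wide tree into the loop below c and a tall tree in place of o,
  -- so the width at the matching depth grows by one.
  fat-loop : ∀ d a {c o s D} → Subtree c s D → state s ≡ state (attach d a c o) →
             Tall (state o) → Fat (state (attach d a c o))
  fat-loop d a {c} {o} P s≡t tall-o zero = 0 , attach d a c o , refl , z≤n
  fat-loop d a {D = D} P s≡t tall-o (suc k) =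
    let y , wide           = fat-loop d a P s≡t tall-o k
        c′ , c′≡c , k≤wc′  = graft-HasWidth P (subst (λ p → HasWidth p y k) (sym s≡t) wide)
        o′ , o′≡o , 1≤wo′  = tall-o (D + y)
    in suc (D + y) , attach d a c′ o′ , state-attach d a c′≡c o′≡o , (begin
      suc k                                  ≡⟨ +-comm 1 k ⟩
      k + 1                                  ≤⟨ +-mono-≤ k≤wc′ 1≤wo′ ⟩
      width c′ (D + y) + width o′ (D + y)    ≡⟨ width-attach d a c′ o′ (D + y) ⟨
      width (attach d a c′ o′) (suc (D + y)) ∎)
    where open ≤-Reasoning

  states-nonempty : ∀ t → ∣ states t ∣ > 0
  states-nonempty t = x∈p⇒∣p∣>0 (state∈states t)

  tall⊎deep-attach : ∀ d a c o {y} → Tall (state c) ⊎ y < ∣ states c ∣ →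
                     Tall (state (attach d a c o)) ⊎ suc y < ∣ states (attach d a c o) ∣
  tall⊎deep-attach d a c o (inj₁ tall) = inj₁ (tall-up {attach d a c o} (down d here) tall)
  tall⊎deep-attach d a c o (inj₂ y<c) with state (attach d a c o) ∈? states c
  ... | yes t∈c = let s , D , P , s≡t = ∈states⇒subtree c t∈c in inj₁ (tall-loop (down d P) s≡t)
  ... | no  t∉c = inj₂ (≤-trans (s≤s y<c) (∣states∣-< (attach d a c o) c (states-attach-child d a c o) t∉c))

  -- A path of length y without repeated states needs y + 1 distinct states.
  tall⊎deep : ∀ t y → width t y > 0 → Tall (state t) ⊎ y < ∣ states t ∣
  tall⊎deep t            zero    _   = inj₂ (states-nonempty t)
  tall⊎deep (leaf a)     (suc y) ()
  tall⊎deep (node a l r) (suc y) w>0 with m+n>0⇒m>0⊎n>0 (width l y) w>0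
  ... | inj₁ wl>0 = tall⊎deep-attach ↙ a l r (tall⊎deep l y wl>0)
  ... | inj₂ wr>0 = tall⊎deep-attach ↘ a r l (tall⊎deep r y wr>0)

  2^[∣states∣∸1]-mono : ∀ c t → states c ⊆ states t → 2 ^ (∣ states c ∣ ∸ 1) ≤ 2 ^ (∣ states t ∣ ∸ 1)
  2^[∣states∣∸1]-mono c t c⊆t = ^-monoʳ-≤ 2 (∸-monoˡ-≤ 1 (p⊆q⇒∣p∣≤∣q∣ c⊆t))

  fat⊎narrow-repeat : ∀ d a c o {y} → state (attach d a c o) ∈ states c →
                      width c y ≤ 2 ^ (∣ states c ∣ ∸ 1) →
                      Fat (state (attach d a c o))
                      ⊎ width (attach d a c o) (suc y) ≤ 2 ^ (∣ states (attach d a c o) ∣ ∸ 1)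
  fat⊎narrow-repeat d a c o {y} t∈c narrow-c with ∈states⇒subtree c t∈c | width o y ≟ 0
  ... | s , D , P , s≡t | yes wo≡0 = inj₂ (begin
    width (attach d a c o) (suc y)          ≡⟨ width-attach d a c o y ⟩
    width c y + width o y                   ≡⟨ cong (width c y +_) wo≡0 ⟩
    width c y + 0                           ≡⟨ +-identityʳ _ ⟩
    width c y                               ≤⟨ narrow-c ⟩
    2 ^ (∣ states c ∣ ∸ 1)                  ≤⟨ 2^[∣states∣∸1]-mono c (attach d a c o) (states-attach-child d a c o) ⟩
    2 ^ (∣ states (attach d a c o) ∣ ∸ 1)   ∎)
    where open ≤-Reasoning
  ... | s , D , P , s≡t | no wo≢0 with tall⊎deep o y (n≢0⇒n>0 wo≢0)
  ...   | inj₁ tall-o = inj₁ (fat-loop d a P s≡t tall-o)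
  ...   | inj₂ y<o with state (attach d a c o) ∈? states o
  ...     | yes t∈o = inj₁ (fat-loop d a P s≡t (tall-in-states o (tall-loop (down d P) s≡t) t∈o))
  ...     | no  t∉o = inj₂ (begin
    width (attach d a c o) (suc y)          ≤⟨ width≤2^ (attach d a c o) (suc y) ⟩
    2 ^ suc y                               ≤⟨ ^-monoʳ-≤ 2 (∸-monoˡ-≤ 1 2+y≤∣t∣) ⟩
    2 ^ (∣ states (attach d a c o) ∣ ∸ 1)   ∎)
    where
    open ≤-Reasoning
    2+y≤∣t∣ : suc (suc y) ≤ ∣ states (attach d a c o) ∣
    2+y≤∣t∣ = ≤-trans (s≤s y<o) (∣states∣-< (attach d a c o) o (states-attach-sibling d a c o) t∉o)

  fat⊎narrow-node : ∀ a l r {y} →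
                    width l y ≤ 2 ^ (∣ states l ∣ ∸ 1) → width r y ≤ 2 ^ (∣ states r ∣ ∸ 1) →
                    Fat (state (node a l r))
                    ⊎ width (node a l r) (suc y) ≤ 2 ^ (∣ states (node a l r) ∣ ∸ 1)
  fat⊎narrow-node a l r narrow-l narrow-r
    with state (node a l r) ∈? states l | state (node a l r) ∈? states r
  ... | yes t∈l | _       = fat⊎narrow-repeat ↙ a l r t∈l narrow-l
  ... | no  _   | yes t∈r = fat⊎narrow-repeat ↘ a r l t∈r narrow-r
  ... | no  t∉l | no  t∉r = inj₂ (≤-trans (+-mono-≤ narrow-l narrow-r)
                               (2^m+2^n≤2^o (pred-< l (states-attach-child ↙ a l r) t∉l)
                                            (pred-< r (states-attach-child ↘ a r l) t∉r)))
    where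
    pred-< : ∀ c → states c ⊆ states (node a l r) → state (node a l r) ∉ states c →
             ∣ states c ∣ ∸ 1 < ∣ states (node a l r) ∣ ∸ 1
    pred-< c c⊆t t∉c = ∸-monoˡ-< (∣states∣-< (node a l r) c c⊆t t∉c) (states-nonempty c)

  fat⊎narrow : ∀ t y → Fat (state t) ⊎ width t y ≤ 2 ^ (∣ states t ∣ ∸ 1)
  fat⊎narrow t            zero    = inj₂ (≤-trans (≤-reflexive (width-zero t)) (m^n>0 2 (∣ states t ∣ ∸ 1)))
  fat⊎narrow (leaf a)     (suc y) = inj₂ z≤n
  fat⊎narrow (node a l r) (suc y) with fat⊎narrow l y | fat⊎narrow r y
  ... | inj₁ fat-l    | _            = inj₁ (fat-up {node a l r} (down ↙ here) fat-l)
  ... | inj₂ _        | inj₁ fat-r   = inj₁ (fat-up {node a l r} (down ↘ here) fat-r)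
  ... | inj₂ narrow-l | inj₂ narrow-r = fat⊎narrow-node a l r narrow-l narrow-r

  wide⇒fat : ∀ t y → 2 ^ (n ∸ 1) < width t y → Fat (state t)
  wide⇒fat t y wide with fat⊎narrow t y
  ... | inj₁ fat    = fat
  ... | inj₂ narrow = ⊥-elim (<⇒≱ wide (≤-trans narrow (^-monoʳ-≤ 2 (∸-monoˡ-≤ 1 (∣p∣≤n (states t))))))

  slim⇒¬fat : Slim A → ∀ {q} → F q ≡ true → ¬ Fat q
  slim⇒¬fat (K , _ , thin) Fq fat =
    let y , u , u≡q , K<w = fat (suc K)
    in <⇒≱ K<w (≤-trans (width≤thickness u y) (thin u (subst (λ p → F p ≡ true) (sym u≡q) Fq)))

  slim⇒thickness≤ : Slim A → LangThickness≤ A (2 ^ (n ∸ 1))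
  slim⇒thickness≤ slim t t∈L = thickness-lub t narrow
    where
    narrow : ∀ y → width t y ≤ 2 ^ (n ∸ 1)
    narrow y with width t y ≤? 2 ^ (n ∸ 1)
    ... | yes w≤ = w≤
    ... | no  w≰ = ⊥-elim (slim⇒¬fat slim t∈L (wide⇒fat t y (≰⇒> w≰)))

  module _ (reduced : Reduced A) where

    cap : ℕ
    cap = suc (2 ^ (n ∸ 1))

    candidate : (Fin n → ℕ) → Fin n → Fin m → Fin n → Fin n → ℕ
    candidate w p a q₁ q₂ with δ a q₁ q₂ ≟ᶠ p
    ... | yes _ = w q₁ + w q₂
    ... | no  _ = 0

    extend : (Fin n → ℕ) → Fin n → ℕ
    extend w p = cap ⊓ ⨆ m λ a → ⨆ n λ q₁ → ⨆ n λ q₂ → candidate w p a q₁ q₂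

    -- cappedWidth y p = cap ⊓ (the largest width at depth y of a tree in state p).  Capping
    -- just above 2ⁿ⁻¹ keeps the sequence finite-valued but still detects fat states.
    cappedWidth : ℕ → Fin n → ℕ
    cappedWidth zero    _ = 1
    cappedWidth (suc y)   = extend (cappedWidth y)

    cappedWidth≤cap : ∀ y p → cappedWidth y p ≤ cap
    cappedWidth≤cap zero    p = s≤s z≤n
    cappedWidth≤cap (suc y) p = m⊓n≤m _ _

    extend-cong : ∀ {w w′} → w ≗ w′ → extend w ≗ extend w′
    extend-cong {w} {w′} w≗w′ p =
      cong (cap ⊓_) (⨆-cong λ a → ⨆-cong λ q₁ → ⨆-cong λ q₂ → candidate-cong a q₁ q₂)
      where
      candidate-cong : ∀ a q₁ q₂ → candidate w p a q₁ q₂ ≡ candidate w′ p a q₁ q₂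
      candidate-cong a q₁ q₂ with δ a q₁ q₂ ≟ᶠ p
      ... | yes _ = cong₂ _+_ (w≗w′ q₁) (w≗w′ q₂)
      ... | no  _ = refl

    extend-≥ : ∀ w a q₁ q₂ → cap ⊓ (w q₁ + w q₂) ≤ extend w (δ a q₁ q₂)
    extend-≥ w a q₁ q₂ = ⊓-monoʳ-≤ cap
      (≤-trans (≤-reflexive candidate-self) (≤-trans (≤-⨆ _ q₂) (≤-trans (≤-⨆ _ q₁) (≤-⨆ _ a))))
      where
      candidate-self : w q₁ + w q₂ ≡ candidate w (δ a q₁ q₂) a q₁ q₂
      candidate-self with δ a q₁ q₂ ≟ᶠ δ a q₁ q₂
      ... | yes _ = refl
      ... | no  ≢ = ⊥-elim (≢ refl)

    cappedWidth-realised : ∀ y p → HasWidth p y (cappedWidth y p)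
    cappedWidth-realised zero p = let t , t≡p = reduced p in t , t≡p , ≤-reflexive (sym (width-zero t))
    cappedWidth-realised (suc y) p = HasWidth-≤ (m⊓n≤n _ _)
      (⨆-preserves P P0 λ a → ⨆-preserves P P0 λ q₁ → ⨆-preserves P P0 λ q₂ → realise a q₁ q₂)
      where
      P : ℕ → Set
      P = HasWidth p (suc y)

      P0 : P 0
      P0 = let t , t≡p = reduced p in t , t≡p , z≤n

      realise : ∀ a q₁ q₂ → P (candidate (cappedWidth y) p a q₁ q₂)
      realise a q₁ q₂ with δ a q₁ q₂ ≟ᶠ p
      ... | no  _   = P0
      ... | yes δ≡p =
        let t₁ , t₁≡q₁ , w₁ = cappedWidth-realised y q₁
            t₂ , t₂≡q₂ , w₂ = cappedWidth-realised y q₂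
        in node a t₁ t₂ , trans (cong₂ (δ a) t₁≡q₁ t₂≡q₂) δ≡p , +-mono-≤ w₁ w₂

    cappedWidth-≥ : ∀ t y → cap ⊓ width t y ≤ cappedWidth y (state t)
    cappedWidth-≥ t            zero    rewrite width-zero t = m⊓n≤n cap 1
    cappedWidth-≥ (leaf a)     (suc y) = z≤n
    cappedWidth-≥ (node a l r) (suc y) = begin
      cap ⊓ (width l y + width r y)                              ≤⟨ ⊓-glb (m⊓n≤m cap _) (m⊓[n+o]≤m⊓n+m⊓o cap (width l y) (width r y)) ⟩
      cap ⊓ (cap ⊓ width l y + cap ⊓ width r y)                  ≤⟨ ⊓-monoʳ-≤ cap (+-mono-≤ (cappedWidth-≥ l y) (cappedWidth-≥ r y)) ⟩
      cap ⊓ (cappedWidth y (state l) + cappedWidth y (state r))  ≤⟨ extend-≥ (cappedWidth y) a (state l) (state r) ⟩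
      cappedWidth (suc y) (state (node a l r))                   ∎
      where open ≤-Reasoning

    -- By early-occurrence, every level's capped widths already occur at a level ≤ (cap + 1)ⁿ.
    Saturated : Fin n → Set
    Saturated q = ∃[ i ] cappedWidth (toℕ {suc (suc cap ^ n)} i) q ≡ cap

    saturated? : ∀ q → Dec (Saturated q)
    saturated? q = any? λ i → cappedWidth (toℕ i) q ≟ cap

    saturated⇒fat : ∀ {q} → Saturated q → Fat q
    saturated⇒fat {q} (i , saturated) with cappedWidth-realised (toℕ i) q
    ... | t , refl , w = wide⇒fat t (toℕ i) (subst (_≤ width t (toℕ i)) saturated w)

    unsaturated⇒narrow : ∀ t → ¬ Saturated (state t) → ∀ y → width t y ≤ 2 ^ (n ∸ 1)
    unsaturated⇒narrow t unsaturated y with width t y ≤? 2 ^ (n ∸ 1)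
    ... | yes w≤ = w≤
    ... | no  w≰ =
      let i , i≤N , i≗y = early-occurrence cappedWidth cappedWidth≤cap extend-cong y
      in ⊥-elim (unsaturated (fromℕ< (s≤s i≤N) ,
           trans (cong (λ j → cappedWidth j (state t)) (toℕ-fromℕ< (s≤s i≤N))) (trans (i≗y _) reaches-cap)))
      where
      reaches-cap : cappedWidth y (state t) ≡ cap
      reaches-cap = ≤-antisym (cappedWidth≤cap y _)
        (subst (_≤ cappedWidth y (state t)) (m≤n⇒m⊓n≡m (≰⇒> w≰)) (cappedWidth-≥ t y))

    slim? : Dec (Slim A)
    slim? = map′ unsaturated⇒slim slim⇒unsaturated (all? λ q → (F q ≟ᵇ true) →-dec ¬? (saturated? q))
      where
      unsaturated⇒slim : (∀ q → F q ≡ true → ¬ Saturated q) → Slim A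
      unsaturated⇒slim unsat = 2 ^ (n ∸ 1) , m^n>0 2 (n ∸ 1) ,
        λ t t∈L → thickness-lub t (unsaturated⇒narrow t (unsat (state t) t∈L))

      slim⇒unsaturated : Slim A → ∀ q → F q ≡ true → ¬ Saturated q
      slim⇒unsaturated slim q Fq = slim⇒¬fat slim Fq ∘ saturated⇒fat

theorem3p2 : ((m n : ℕ) (A : Automaton m n) → Reduced A → Dec (Slim A))
           × ((m n : ℕ) (A : Automaton m n) → Reduced A → Slim A →
                LangThickness≤ A (2 ^ (n ∸ 1)))
theorem3p2 = (λ m n A reduced → slim? A reduced) , (λ m n A _ → slim⇒thickness≤ A)
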